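{- The minimum number of disjoint monochromatic triangles in a $2$-coloring of the edges of a complete graph on $n$ vertices is $$\left\lfloor \frac{n-2}{3}\right\rfloor.$$ That is, the minimum, over all red-blue colorings of the edges of the complete graph $K_n$, of the maximum number of pairwise vertex-disjoint monochromatic triangles in the coloring equals $\left\lfloor \frac{n-2}{3}\right\rfloor$.
   Context: $K_n$ denotes the complete graph on $n$ vertices. A $2$-coloring assigns to each edge one of the colors red, blue. A triangle is monochromatic if its three edges have the same color. Two triangles are disjoint if they share no vertex; different triangles in a disjoint family may have different colors.
   Formalization: The formal theorem assumes n ≥ 2 and n ≠ 5: for n = 5 a red 5-cycle with its complementary blue 5-cycle has no monochromatic triangle although the formula gives 1, and for n = 0, 1 the formula gives −1 although the minimum is 0. -}

module Defs where

open import Data.Fin using (Fin)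
open import Data.Fin.Subset using (Subset; _∈_; _∩_; ∣_∣; Empty)
open import Data.List using (List; length)
open import Data.List.Relation.Unary.All using (All)
open import Data.List.Relation.Unary.AllPairs using (AllPairs)
open import Data.Nat using (ℕ; _≤_)
open import Data.Product using (_×_; ∃; ∃-syntax)
open import Relation.Binary.PropositionalEquality using (_≡_; _≢_)

data Colour : Set where
  red blue : Colour

-- A 2-colouring of the edges of the complete graph on Fin n.  The values
-- colour i i are junk: no definition below depends on them.
record Colouring (n : ℕ) : Set where
  field
    colour    : Fin n → Fin n → Colour
    symmetric : ∀ i j → colour i j ≡ colour j i

open Colouring public

-- In a complete graph every 3-element vertex set spans a triangle.
record Triangle (n : ℕ) : Set where
  field
    vertices : Subset n
    size     : ∣ vertices ∣ ≡ 3

open Triangle public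

Monochromatic : ∀ {n} → Colouring n → Triangle n → Set
Monochromatic {n} χ T =
  ∃[ c ] (∀ (i j : Fin n) → i ∈ vertices T → j ∈ vertices T → i ≢ j →
          colour χ i j ≡ c)

Disjoint : ∀ {n} → Triangle n → Triangle n → Set
Disjoint S T = Empty (vertices S ∩ vertices T)

-- The triangles of a family need not all have the same colour.
IsDisjointMonochromaticFamily : ∀ {n} → Colouring n → List (Triangle n) → Set
IsDisjointMonochromaticFamily χ Ts = All (Monochromatic χ) Ts × AllPairs Disjoint Ts

-- Triangles are nonempty, so pairwise disjoint ones are distinct and the
-- length of the list is the number of triangles.
HasDisjointMonochromaticTriangles : ∀ {n} → Colouring n → ℕ → Set
HasDisjointMonochromaticTriangles χ k =
  ∃[ Ts ] (IsDisjointMonochromaticFamily χ Ts × length Ts ≡ k)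

IsMaximum : (ℕ → Set) → ℕ → Set
IsMaximum P m = P m × (∀ k → P k → k ≤ m)

IsMinimum : (ℕ → Set) → ℕ → Set
IsMinimum P m = P m × (∀ k → P k → m ≤ k)

IsMaxDisjointMonochromaticTriangles : ∀ {n} → Colouring n → ℕ → Set
IsMaxDisjointMonochromaticTriangles χ =
  IsMaximum (HasDisjointMonochromaticTriangles χ)

IsMinDisjointMonochromaticTriangles : ℕ → ℕ → Set
IsMinDisjointMonochromaticTriangles n =
  IsMinimum (λ m → ∃ λ (χ : Colouring n) → IsMaxDisjointMonochromaticTriangles χ m)

{-# OPTIONS --safe #-}

-- Upper bound: take a pair U of vertices, and colour an edge blue exactly when
-- it joins U to its complement.  A monochromatic triangle meeting U would lie
-- inside U, so the disjoint triangles all live on the other n − 2 vertices.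
--
-- Lower bound: K₆ contains a monochromatic triangle, so one can remove triangles
-- three vertices at a time, down to K₈, where two disjoint triangles are needed.
-- Remove a triangle from K₈: if the remaining K₅ has no monochromatic triangle,
-- it is a red pentagon with blue diagonals, and only the 15 edges between the
-- triangle and the pentagon are unknown.  The three finite facts (K₆, K₅, K₈)
-- are obtained by splitting on the colours of the edges one after the other.
module Submission where

open import Defs
open import Data.Bool using (true; false; if_then_else_)
open import Data.Bool.Properties using (¬-not)
open import Data.Fin using (Fin; zero; suc)
open import Data.Fin.Patterns
open import Data.Fin.Properties using (any?) renaming (_≟_ to _≟ᶠ_; _≤?_ to _≤ᶠ?_)
open import Data.Fin.Subset using (Subset; Side; inside; outside; _∈_; _∉_; _∩_; _∪_; ∣_∣; ⋃; ⁅_⁆; Empty)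
open import Data.Fin.Subset.Properties using (_∈?_; ∉⊥; ∣⊥∣≡0; ∣⁅x⁆∣≡1; ∣p∣≤n; p⊆q⇒∣p∣≤∣q∣; x∈⁅x⁆; x∈⁅y⁆⇒x≡y; x∈p∩q⁺; x∈p∩q⁻; x∈p∪q⁺; x∈p∪q⁻; drop-∷-Empty)
open import Data.List using (List; []; _∷_; [_]; _++_; length; map; concatMap; cartesianProduct; cartesianProductWith; allFin; lookup; foldr; take; drop)
open import Data.List.Membership.Propositional using () renaming (_∈_ to _∈ˡ_)
open import Data.List.Membership.Propositional.Properties using (∈-++⁺ˡ; ∈-++⁺ʳ)
open import Data.List.Properties using (length-map; length-tabulate; length-take; take++drop≡id)
open import Data.List.Relation.Binary.Permutation.Propositional using (_↭_; ↭-refl; ↭-prep; ↭-swap; ↭-sym; ↭-trans; ↭⇒↭ₛ)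
open import Data.List.Relation.Binary.Permutation.Propositional.Properties using (shift; ∈-resp-↭; ↭-length; ++⁺ʳ) renaming (map⁺ to ↭-map⁺)
open import Data.List.Relation.Binary.Permutation.Setoid.Properties using (Unique-resp-↭)
open import Data.List.Relation.Unary.All as All using (All; []; _∷_)
import Data.List.Relation.Unary.All.Properties as All
open import Data.List.Relation.Unary.AllPairs as AllPairs using (AllPairs; []; _∷_)
import Data.List.Relation.Unary.AllPairs.Properties as AllPairs
open import Data.List.Relation.Unary.Any using (Any; here; there)
open import Data.List.Relation.Unary.Unique.Propositional using (Unique)
open import Data.List.Relation.Unary.Unique.Propositional.Properties using (allFin⁺)
open import Data.Maybe as Maybe using (Maybe; just; nothing; zipWith; _<∣>_; from-just)
open import Data.Nat using (ℕ; zero; suc; _+_; _*_; _≤_; _<_; _∸_; _/_; s≤s; s≤s⁻¹)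
open import Data.Nat.DivMod using (m/n*n≤m; m*n/n≡m; /-monoˡ-≤)
open import Data.Nat.Properties using (≤-reflexive; ≤-trans; <⇒≱; ≤∧≢⇒<; m≤n+m; m≤m+n; m≤n⇒m⊓n≡m; +-suc; *-identityʳ)
open import Data.Product using (∃-syntax; _×_; _,_; proj₁; proj₂; uncurry)
open import Data.Product.Properties using (≡-dec)
open import Data.Sum using (_⊎_; inj₁; inj₂; [_,_]′)
open import Data.Vec as Vec using (Vec; []; _∷_; toList)
open import Data.Vec.Properties using ([]=⇒lookup; lookup⇒[]=)
open import Function using (_∘_; _∋_; id)
open import Relation.Binary using (DecidableEquality)
open import Relation.Binary.PropositionalEquality using (_≡_; _≢_; refl; sym; trans; cong; cong₂; subst; setoid)
open import Relation.Nullary using (does; yes; no; contradiction; ¬?; _×-dec_)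
open import Relation.Nullary.Decidable using (decidable-stable)

private variable
  A B : Set
  k m n : ℕ
  xs ys : List A

_≟ᶜ_ : DecidableEquality Colour
red  ≟ᶜ red  = yes refl
red  ≟ᶜ blue = no λ ()
blue ≟ᶜ red  = no λ ()
blue ≟ᶜ blue = yes refl

-- Disjunctive normal forms over two-valued variables

module Tautology {V : Set} (_≟_ : DecidableEquality V) (v : V → Colour) where

  Literal Term : Set
  Literal = V × Colour
  Term = List Literal

  Holds : Literal → Set
  Holds (x , c) = v x ≡ c

  Satisfied : List Term → Set
  Satisfied = Any (All Holds)

  -- `nothing` means that the term contains the opposite literal and is false; otherwise the
  -- literals not yet settled remain.
  restrictTerm : Literal → Term → Maybe Term
  restrictTerm l       []            = just []
  restrictTerm (x , c) ((y , d) ∷ t) with x ≟ y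
  ... | no  _ = Maybe.map ((y , d) ∷_) (restrictTerm (x , c) t)
  ... | yes _ with c ≟ᶜ d
  ...   | no  _ = nothing
  ...   | yes _ = restrictTerm (x , c) t

  restrictTerm-sound : ∀ l t {t′} → restrictTerm l t ≡ just t′ → Holds l → All Holds t′ → All Holds t
  restrictTerm-sound l       []            eq h hs = []
  restrictTerm-sound (x , c) ((y , d) ∷ t) eq h hs with x ≟ y
  restrictTerm-sound (x , c) ((y , d) ∷ t) eq h hs | no _ with restrictTerm (x , c) t in eq′
  restrictTerm-sound (x , c) ((y , d) ∷ t) refl h (h′ ∷ hs) | no _ | just _ =
    h′ ∷ restrictTerm-sound (x , c) t eq′ h hs
  restrictTerm-sound (x , c) ((y , d) ∷ t) eq h hs | yes refl with c ≟ᶜ d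
  ... | yes refl = h ∷ restrictTerm-sound (x , c) t eq h hs

  restrict : Literal → List Term → List Term
  restrict l []      = []
  restrict l (t ∷ D) with restrictTerm l t
  ... | just t′ = t′ ∷ restrict l D
  ... | nothing = restrict l D

  restrict-sound : ∀ l D → Holds l → Satisfied (restrict l D) → Satisfied D
  restrict-sound l (t ∷ D) h s with restrictTerm l t in eq
  restrict-sound l (t ∷ D) h (here hs) | just _  = here (restrictTerm-sound l t eq h hs)
  restrict-sound l (t ∷ D) h (there s) | just _  = there (restrict-sound l D h s)
  restrict-sound l (t ∷ D) h s         | nothing = there (restrict-sound l D h s)

  restrictAll : List Literal → List Term → List Term
  restrictAll ls D = foldr restrict D ls

  restrictAll-sound : ∀ {ls} D → All Holds ls → Satisfied (restrictAll ls D) → Satisfied D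
  restrictAll-sound D []       s = s
  restrictAll-sound D (h ∷ hs) s = restrictAll-sound D hs (restrict-sound _ _ h s)

  trivial? : ∀ D → Maybe (Satisfied D)
  trivial? []            = nothing
  trivial? ([] ∷ D)      = just (here [])
  trivial? ((_ ∷ _) ∷ D) = Maybe.map there (trivial? D)

  splitOn : ∀ x D → Satisfied (restrict (x , red) D) → Satisfied (restrict (x , blue) D) → Satisfied D
  splitOn x D r b with v x in eq
  ... | red  = restrict-sound (x , red)  D eq r
  ... | blue = restrict-sound (x , blue) D eq b

  -- The search inspects only `D`, never the values of `v`, so it computes even when the colouring
  -- is a variable. An empty term is a true conjunction, and a branch ends as soon as one appears.
  tautology? : List V → ∀ D → Maybe (Satisfied D)
  tautology? []       D = trivial? D
  tautology? (x ∷ xs) D =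
    trivial? D <∣>
    zipWith (splitOn x D) (tautology? xs (restrict (x , red) D)) (tautology? xs (restrict (x , blue) D))

  -- Separates the data that the search computes with, `term`, from the proof that these colours
  -- yield the goal.
  record Candidate (G : Set) : Set where
    constructor candidate
    field
      term  : Term
      sound : All Holds term → G
  open Candidate public

  mapCandidate : ∀ {G H} → (G → H) → Candidate G → Candidate H
  mapCandidate f (candidate t s) = candidate t (f ∘ s)

  realise : ∀ {G} (cs : List (Candidate G)) → Satisfied (map term cs) → G
  realise (c ∷ cs) (here hs) = sound c hs
  realise (c ∷ cs) (there s) = realise cs s

-- Packings of triangles

record MonoTriangle (χ : A → A → Colour) (x y z : A) : Set where
  constructor mono
  field
    hue : Colour
    xy  : χ x y ≡ hue
    xz  : χ x z ≡ hue
    yz  : χ y z ≡ hue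

-- The triangles are disjoint because the vertices of each one are removed from
-- the list before the next one is chosen.
data Packing (χ : A → A → Colour) : List A → ℕ → Set where
  done : Packing χ xs 0
  step : ∀ {x y z} → xs ↭ x ∷ y ∷ z ∷ ys → MonoTriangle χ x y z → Packing χ ys k → Packing χ xs (suc k)

module _ {χ : A → A → Colour} where

  resp-↭ : xs ↭ ys → Packing χ xs k → Packing χ ys k
  resp-↭ r done         = done
  resp-↭ r (step s t p) = step (↭-trans (↭-sym r) s) t p

  weaken : ∀ ys → Packing χ xs k → Packing χ (xs ++ ys) k
  weaken ys done         = done
  weaken ys (step s t p) = step (++⁺ʳ ys s) t (weaken ys p)

  skip : ∀ x → Packing χ xs k → Packing χ (x ∷ xs) k
  skip x done = done
  skip x (step {x = a} {b} {c} s t p) =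
    step (↭-trans (↭-prep x s) (↭-sym (shift x (a ∷ b ∷ c ∷ []) _))) t (skip x p)

-- Carries the facts about `Fin n` over to lists of vertices, with `lookup` as `f`. Disjointness is
-- recorded by positions in the list, so `f` can be any map.
map-packing : {χ : B → B → Colour} (f : A → B) → Packing (λ x y → χ (f x) (f y)) xs k → Packing χ (map f xs) k
map-packing f done                      = done
map-packing f (step s (mono c p q r) t) = step (↭-map⁺ f s) (mono c p q r) (map-packing f t)

-- Enumerating subsequences and permutations

record Choice (k : ℕ) (xs : List A) : Set where
  constructor choice
  field
    chosen : Vec A k
    {rest} : List A
    split  : xs ↭ toList chosen ++ rest

-- Chosen and remaining elements both keep their order, so the triangles found in `allFin n` only
-- use edges with increasing endpoints.
choices : ∀ k (xs : List A) → List (Choice k xs)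
choices zero    xs       = [ choice [] ↭-refl ]
choices (suc k) []       = []
choices (suc k) (x ∷ xs) = map pick (choices k xs) ++ map leave (choices (suc k) xs)
  where
  pick : Choice k xs → Choice (suc k) (x ∷ xs)
  pick (choice c s) = choice (x ∷ c) (↭-prep x s)

  leave : Choice (suc k) xs → Choice (suc k) (x ∷ xs)
  leave (choice c s) = choice c (↭-trans (↭-prep x s) (↭-sym (shift x (toList c) _)))

insertions : ∀ (x : A) (ys : List A) → List (∃[ zs ] x ∷ ys ↭ zs)
insertions x []       = [ [ x ] , ↭-refl ]
insertions x (y ∷ ys) =
  (x ∷ y ∷ ys , ↭-refl) ∷ map (λ (zs , p) → y ∷ zs , ↭-trans (↭-swap x y ↭-refl) (↭-prep y p)) (insertions x ys)

permutations : ∀ (xs : List A) → List (∃[ ys ] xs ↭ ys)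
permutations []       = [ [] , ↭-refl ]
permutations (x ∷ xs) = concatMap
  (λ (ys , p) → map (λ (zs , q) → zs , ↭-trans (↭-prep x p) q) (insertions x ys))
  (permutations xs)

pairs : List A → List (A × A)
pairs []       = []
pairs (x ∷ xs) = map (x ,_) xs ++ pairs xs

-- Up to relabelling, the only 2-colouring of K₅ without a monochromatic triangle. The diagonals
-- also form a 5-cycle, so exchanging the colours gives nothing new.
pentagon : (a b c d e : A) → List ((A × A) × Colour)
pentagon a b c d e =
  ((a , b) , red)  ∷ ((b , c) , red)  ∷ ((c , d) , red)  ∷ ((d , e) , red)  ∷ ((e , a) , red)  ∷
  ((a , c) , blue) ∷ ((b , d) , blue) ∷ ((c , e) , blue) ∷ ((d , a) , blue) ∷ ((e , b) , blue) ∷ []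

ColouredAs : (A → A → Colour) → List ((A × A) × Colour) → Set
ColouredAs χ = All (λ ((x , y) , c) → χ x y ≡ c)

Pentagonal : (A → A → Colour) → List A → Set
Pentagonal χ xs = ∃[ a ] ∃[ b ] ∃[ c ] ∃[ d ] ∃[ e ]
  xs ↭ a ∷ b ∷ c ∷ d ∷ e ∷ [] × ColouredAs χ (pentagon a b c d e)

-- The finite searches

module Search {n : ℕ} (χ : Fin n → Fin n → Colour) where

  open Tautology (≡-dec _≟ᶠ_ _≟ᶠ_) (uncurry χ) public

  addTriangle : ∀ {xs x y z} → xs ↭ x ∷ y ∷ z ∷ ys → Colour →
                Candidate (Packing χ ys k) → Candidate (Packing χ xs (suc k))
  addTriangle {x = x} {y} {z} s c (candidate t p) =
    candidate (((x , y) , c) ∷ ((x , z) , c) ∷ ((y , z) , c) ∷ t)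
      λ { (xy ∷ xz ∷ yz ∷ hs) → step s (mono c xy xz yz) (p hs) }

  -- Triangles are listed by increasing first vertex, so that each family occurs
  -- once: a vertex that does not start the first triangle is left out for good.
  packings : ∀ k xs → List (Candidate (Packing χ xs k))
  packings zero    xs       = [ candidate [] (λ _ → done) ]
  packings (suc k) []       = []
  packings (suc k) (x ∷ xs) = concatMap extend (choices 2 xs) ++ map (mapCandidate (skip x)) (packings (suc k) xs)
    where
    extend : Choice 2 xs → List (Candidate (Packing χ (x ∷ xs) (suc k)))
    extend (choice (y ∷ z ∷ []) {ys} s) =
      cartesianProductWith (addTriangle (↭-prep x s)) (red ∷ blue ∷ []) (packings k ys)

  -- The searches only split on edges whose endpoints are in increasing order.
  sort : Fin n × Fin n → Fin n × Fin n
  sort (x , y) = if does (x ≤ᶠ? y) then (x , y) else (y , x)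

  module _ (symmetric : ∀ x y → χ x y ≡ χ y x) where

    sort-sound : ∀ e → uncurry χ (sort e) ≡ uncurry χ e
    sort-sound (x , y) with does (x ≤ᶠ? y)
    ... | true  = refl
    ... | false = symmetric y x

    sortTerm : Term → Term
    sortTerm = map (λ (e , c) → sort e , c)

    sortTerm-sound : ∀ t → All Holds (sortTerm t) → All Holds t
    sortTerm-sound []            []       = []
    sortTerm-sound ((e , c) ∷ t) (h ∷ hs) = trans (sym (sort-sound e)) h ∷ sortTerm-sound t hs

    pentagons : ∀ xs → List (Candidate (Pentagonal χ xs))
    pentagons xs = concatMap toCandidate (permutations xs)
      where
      toCandidate : ∃[ ys ] xs ↭ ys → List (Candidate (Pentagonal χ xs))
      toCandidate (a ∷ b ∷ c ∷ d ∷ e ∷ [] , p) =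
        -- An arbitrary ordering of the vertices produces pairs in either direction; sorting turns
        -- them into the variables of the search.
        [ candidate (sortTerm (pentagon a b c d e))
            (λ hs → a , b , c , d , e , p , sortTerm-sound _ hs) ]
      toCandidate _ = []

-- The Ramsey bound R(3,3) ≤ 6. The use of `from-just` type-checks because the search over the 15
-- edges evaluates to a `just`.
triangle-in-K₆ : (χ : Fin 6 → Fin 6 → Colour) → Packing χ (allFin 6) 1
triangle-in-K₆ χ = realise cs (from-just (tautology? (pairs (allFin 6)) (map term cs)))
  where
  open Search χ
  cs : List (Candidate (Packing χ (allFin 6) 1))
  cs = packings 1 (allFin 6)

triangle-or-pentagon-in-K₅ : (χ : Fin 5 → Fin 5 → Colour) → (∀ x y → χ x y ≡ χ y x) →
                             Packing χ (allFin 5) 1 ⊎ Pentagonal χ (allFin 5)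
triangle-or-pentagon-in-K₅ χ symmetric = realise cs (from-just (tautology? (pairs (allFin 5)) (map term cs)))
  where
  open Search χ
  cs : List (Candidate (Packing χ (allFin 5) 1 ⊎ Pentagonal χ (allFin 5)))
  cs = map (mapCandidate inj₁) (packings 1 (allFin 5)) ++ map (mapCandidate inj₂) (pentagons symmetric (allFin 5))

triangle∪pentagon : Colour → (x y z a b c d e : A) → List ((A × A) × Colour)
triangle∪pentagon h x y z a b c d e =
  ((x , y) , h) ∷ ((x , z) , h) ∷ ((y , z) , h) ∷ pentagon a b c d e

-- The 13 known colours, 3 in the triangle and 10 in the pentagon, are substituted first, so that
-- the search splits only on the crossing edges.
two-triangles-in-K₈ : (χ : Fin 8 → Fin 8 → Colour) → (∀ x y → χ x y ≡ χ y x) → ∀ h →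
                      ColouredAs χ (triangle∪pentagon h 0F 1F 2F 3F 4F 5F 6F 7F) → Packing χ (allFin 8) 2
two-triangles-in-K₈ χ symmetric h known = realise cs (restrictAll-sound (map term cs) known′ (search h))
  where
  open Search χ
  cs : List (Candidate (Packing χ (allFin 8) 2))
  cs = packings 2 (allFin 8)

  crossing : List (Fin 8 × Fin 8)
  crossing = cartesianProduct (0F ∷ 1F ∷ 2F ∷ []) (3F ∷ 4F ∷ 5F ∷ 6F ∷ 7F ∷ [])

  facts : Colour → Term
  facts h = sortTerm symmetric (triangle∪pentagon h 0F 1F 2F 3F 4F 5F 6F 7F)

  known′ : All Holds (facts h)
  known′ = All.map⁺ (All.map (trans (sort-sound symmetric _)) known)

  search : ∀ h → Satisfied (restrictAll (facts h) (map term cs))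
  -- The search evaluates only once the colour of the triangle is a constructor.
  search red  = from-just (tautology? crossing (restrictAll (facts red)  (map term cs)))
  search blue = from-just (tautology? crossing (restrictAll (facts blue) (map term cs)))

-- The lower bound

module _ {A : Set} (χ : A → A → Colour) where

  some-triangle : ∀ xs → 6 ≤ length xs → Packing χ xs 1
  some-triangle (a ∷ b ∷ c ∷ d ∷ e ∷ f ∷ ws) _ =
    -- `map (lookup vs) (allFin 6)` computes to `vs`, so the colouring is pulled back to the first
    -- six vertices.
    weaken ws (map-packing (lookup vs) (triangle-in-K₆ λ i j → χ (lookup vs i) (lookup vs j)))
    where
    vs : List A
    vs = a ∷ b ∷ c ∷ d ∷ e ∷ f ∷ []
  some-triangle [] ()
  some-triangle (_ ∷ []) (s≤s ())
  some-triangle (_ ∷ _ ∷ []) (s≤s (s≤s ()))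
  some-triangle (_ ∷ _ ∷ _ ∷ []) (s≤s (s≤s (s≤s ())))
  some-triangle (_ ∷ _ ∷ _ ∷ _ ∷ []) (s≤s (s≤s (s≤s (s≤s ()))))
  some-triangle (_ ∷ _ ∷ _ ∷ _ ∷ _ ∷ []) (s≤s (s≤s (s≤s (s≤s (s≤s ())))))

  module _ (symmetric : ∀ x y → χ x y ≡ χ y x) where

    triangle-or-pentagon : ∀ vs → length vs ≡ 5 → Packing χ vs 1 ⊎ Pentagonal χ vs
    triangle-or-pentagon vs@(_ ∷ _ ∷ _ ∷ _ ∷ _ ∷ []) refl
      with triangle-or-pentagon-in-K₅ (λ i j → χ (lookup vs i) (lookup vs j)) (λ _ _ → symmetric _ _)
    ... | inj₁ p = inj₁ (map-packing (lookup vs) p)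
    ... | inj₂ (a , b , c , d , e , s , hs) =
      inj₂ (_ , _ , _ , _ , _ , ↭-map⁺ (lookup vs) s , All.map⁺ {f = λ ((i , j) , h) → (lookup vs i , lookup vs j) , h} hs)

    beside-pentagon : ∀ {x y z vs} → MonoTriangle χ x y z → Pentagonal χ vs → Packing χ (x ∷ y ∷ z ∷ vs) 2
    beside-pentagon {x} {y} {z} (mono h xy xz yz) (a , b , c , d , e , s , hs) =
      resp-↭ (↭-prep x (↭-prep y (↭-prep z (↭-sym s))))
        (map-packing (lookup us) (two-triangles-in-K₈ _ (λ _ _ → symmetric _ _) h
          (All.map⁻ {f = λ ((i , j) , h) → (lookup us i , lookup us j) , h} (xy ∷ xz ∷ yz ∷ hs))))
      where
      us : List A
      us = x ∷ y ∷ z ∷ a ∷ b ∷ c ∷ d ∷ e ∷ []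

    two-triangles : ∀ xs → 8 ≤ length xs → Packing χ xs 2
    two-triangles xs 8≤ with some-triangle xs (≤-trans (m≤n+m 6 2) 8≤)
    ... | step {ys = ys} s t done = resp-↭ (↭-sym s) (beside t ys (s≤s⁻¹ (s≤s⁻¹ (s≤s⁻¹ (subst (8 ≤_) (↭-length s) 8≤)))))
      where
      beside : ∀ {x y z} → MonoTriangle χ x y z → ∀ ys → 5 ≤ length ys → Packing χ (x ∷ y ∷ z ∷ ys) 2
      beside t ys 5≤ = subst (λ ys → Packing χ (_ ∷ _ ∷ _ ∷ ys) 2) (take++drop≡id 5 ys) (weaken (drop 5 ys)
        ([ step ↭-refl t , beside-pentagon t ]′
          (triangle-or-pentagon (take 5 ys) (trans (length-take 5 ys) (m≤n⇒m⊓n≡m 5≤)))))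

    -- Each triangle removed costs three vertices. The induction starts from two triangles on eight
    -- vertices, since five vertices may span no monochromatic triangle.
    many-triangles : ∀ k xs → 8 + k * 3 ≤ length xs → Packing χ xs (2 + k)
    many-triangles zero    xs 8≤ = two-triangles xs 8≤
    many-triangles (suc k) xs le with some-triangle xs (≤-trans (m≤m+n 6 (5 + k * 3)) le)
    ... | step s t done = step s t (many-triangles k _ (s≤s⁻¹ (s≤s⁻¹ (s≤s⁻¹ (subst (11 + k * 3 ≤_) (↭-length s) le)))))

    packing : ∀ k xs → 2 + k * 3 ≤ length xs → length xs ≢ 5 → Packing χ xs k
    packing 0             xs _  _  = done
    -- The bound alone would allow five vertices, where the pentagon is a counterexample; excluding
    -- five leaves at least six.
    packing 1             xs 5≤ ≢5 = some-triangle xs (≤∧≢⇒< 5≤ (≢5 ∘ sym))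
    packing (suc (suc k)) xs le _  = many-triangles k xs le

-- Cardinalities of disjoint unions

DisjointSubsets : Subset n → Subset n → Set
DisjointSubsets p q = Empty (p ∩ q)

∣p∪q∣≡∣p∣+∣q∣ : ∀ (p q : Subset n) → DisjointSubsets p q → ∣ p ∪ q ∣ ≡ ∣ p ∣ + ∣ q ∣
∣p∪q∣≡∣p∣+∣q∣ []            []            _ = refl
∣p∪q∣≡∣p∣+∣q∣ (outside ∷ p) (outside ∷ q) e = ∣p∪q∣≡∣p∣+∣q∣ p q (drop-∷-Empty e)
∣p∪q∣≡∣p∣+∣q∣ (inside  ∷ p) (outside ∷ q) e = cong suc (∣p∪q∣≡∣p∣+∣q∣ p q (drop-∷-Empty e))
∣p∪q∣≡∣p∣+∣q∣ (outside ∷ p) (inside  ∷ q) e =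
  trans (cong suc (∣p∪q∣≡∣p∣+∣q∣ p q (drop-∷-Empty e))) (sym (+-suc ∣ p ∣ ∣ q ∣))
∣p∪q∣≡∣p∣+∣q∣ (inside  ∷ p) (inside  ∷ q) e = contradiction (zero , Vec.here) e

disjoint-⋃ : ∀ {p : Subset n} {ps} → All (DisjointSubsets p) ps → DisjointSubsets p (⋃ ps)
disjoint-⋃ {p = p} {[]}     []       (x , x∈) = ∉⊥ (proj₂ (x∈p∩q⁻ p _ x∈))
disjoint-⋃ {p = p} {q ∷ ps} (e ∷ es) (x , x∈) with x∈p∩q⁻ p _ x∈
... | x∈p , x∈q∪ with x∈p∪q⁻ q (⋃ ps) x∈q∪
...   | inj₁ x∈q = e (x , x∈p∩q⁺ (x∈p , x∈q))
...   | inj₂ x∈⋃ = disjoint-⋃ es (x , x∈p∩q⁺ (x∈p , x∈⋃))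

-- Applied with `s` equal to 1 for the singletons in `fromList`, and to 3 for the triangles of a
-- family.
∣⋃∣≡length*size : ∀ {s} {ps : List (Subset n)} → AllPairs DisjointSubsets ps → All (λ p → ∣ p ∣ ≡ s) ps →
                  ∣ ⋃ ps ∣ ≡ length ps * s
∣⋃∣≡length*size {n = n} []       []       = ∣⊥∣≡0 n
∣⋃∣≡length*size {ps = p ∷ ps} (e ∷ es) (c ∷ cs) =
  trans (∣p∪q∣≡∣p∣+∣q∣ p (⋃ ps) (disjoint-⋃ e)) (cong₂ _+_ c (∣⋃∣≡length*size es cs))

fromList : List (Fin n) → Subset n
fromList = ⋃ ∘ map ⁅_⁆

∈-fromList⁻ : ∀ (xs : List (Fin n)) {i} → i ∈ fromList xs → i ∈ˡ xs
∈-fromList⁻ []       i∈ = contradiction i∈ ∉⊥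
∈-fromList⁻ (x ∷ xs) i∈ with x∈p∪q⁻ ⁅ x ⁆ _ i∈
... | inj₁ i∈x  = here (x∈⁅y⁆⇒x≡y x i∈x)
... | inj₂ i∈xs = there (∈-fromList⁻ xs i∈xs)

∈-fromList⁺ : ∀ {xs : List (Fin n)} {i} → i ∈ˡ xs → i ∈ fromList xs
∈-fromList⁺ {i = i} (here refl) = x∈p∪q⁺ (inj₁ (x∈⁅x⁆ i))
∈-fromList⁺         (there i∈)  = x∈p∪q⁺ (inj₂ (∈-fromList⁺ i∈))

∣fromList∣ : ∀ {xs : List (Fin n)} → Unique xs → ∣ fromList xs ∣ ≡ length xs
∣fromList∣ {xs = xs} xs! = trans
  (∣⋃∣≡length*size (AllPairs.map⁺ (AllPairs.map singletons-disjoint xs!)) (All.map⁺ (All.universal ∣⁅x⁆∣≡1 xs)))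
  (trans (*-identityʳ _) (length-map ⁅_⁆ xs))
  where
  singletons-disjoint : ∀ {x y} → x ≢ y → DisjointSubsets ⁅ x ⁆ ⁅ y ⁆
  singletons-disjoint {x} {y} x≢y (i , i∈) with x∈p∩q⁻ ⁅ x ⁆ ⁅ y ⁆ i∈
  ... | i∈x , i∈y = x≢y (trans (sym (x∈⁅y⁆⇒x≡y x i∈x)) (x∈⁅y⁆⇒x≡y y i∈y))

-- From packings to families of triangles

triangle : ∀ {a b c : Fin n} → Unique (a ∷ b ∷ c ∷ []) → Triangle n
triangle {a = a} {b} {c} abc! = record { vertices = fromList (a ∷ b ∷ c ∷ []) ; size = ∣fromList∣ abc! }

triangle-monochromatic : ∀ (χ : Colouring n) {a b c} (abc! : Unique (a ∷ b ∷ c ∷ [])) →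
                         MonoTriangle (colour χ) a b c → Monochromatic χ (triangle abc!)
triangle-monochromatic χ {a} {b} {c} abc! (mono h ab ac bc) =
  h , λ i j i∈ j∈ → edge (∈-fromList⁻ (a ∷ b ∷ c ∷ []) i∈) (∈-fromList⁻ (a ∷ b ∷ c ∷ []) j∈)
  where
  flip : ∀ {i j} → colour χ i j ≡ h → colour χ j i ≡ h
  flip {i} {j} = trans (symmetric χ j i)

  edge : ∀ {i j} → i ∈ˡ a ∷ b ∷ c ∷ [] → j ∈ˡ a ∷ b ∷ c ∷ [] → i ≢ j → colour χ i j ≡ h
  edge (here refl)                 (here refl)                 i≢j = contradiction refl i≢j
  edge (here refl)                 (there (here refl))         i≢j = ab
  edge (here refl)                 (there (there (here refl))) i≢j = ac
  edge (there (here refl))         (here refl)                 i≢j = flip ab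
  edge (there (here refl))         (there (here refl))         i≢j = contradiction refl i≢j
  edge (there (here refl))         (there (there (here refl))) i≢j = bc
  edge (there (there (here refl))) (here refl)                 i≢j = flip ac
  edge (there (there (here refl))) (there (here refl))         i≢j = flip bc
  edge (there (there (here refl))) (there (there (here refl))) i≢j = contradiction refl i≢j

AllPairs-++⁻ : ∀ {R : A → A → Set} xs → AllPairs R (xs ++ ys) →
               AllPairs R xs × AllPairs R ys × All (λ x → All (R x) ys) xs
AllPairs-++⁻ []       ps       = [] , ps , []
AllPairs-++⁻ (x ∷ xs) (p ∷ ps) with AllPairs-++⁻ xs ps
... | xs! , ys! , across = All.++⁻ˡ xs p ∷ xs! , ys! , All.++⁻ʳ xs p ∷ across

-- `within` is the induction invariant: triangles that stay inside the remaining list are disjoint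
-- from the one just removed.
record Family (χ : Colouring n) (xs : List (Fin n)) (k : ℕ) : Set where
  field
    triangles : List (Triangle n)
    mono-disj : IsDisjointMonochromaticFamily χ triangles
    count     : length triangles ≡ k
    within    : All (λ T → ∀ i → i ∈ vertices T → i ∈ˡ xs) triangles

toFamily : ∀ (χ : Colouring n) {xs} → Unique xs → Packing (colour χ) xs k → Family χ xs k
toFamily χ xs! done = record { triangles = [] ; mono-disj = [] , [] ; count = refl ; within = [] }
toFamily {n} χ {xs} xs! (step {ys = ys} {x = a} {b} {c} s t p) = record
  { triangles = T ∷ triangles
  ; mono-disj = triangle-monochromatic χ abc! t ∷ proj₁ mono-disj , All.map (λ {S} → apart S) within ∷ proj₂ mono-disj
  ; count     = cong suc count
  ; within    = (λ i i∈ → ∈-resp-↭ (↭-sym s) (∈-++⁺ˡ (∈-fromList⁻ abc i∈)))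
              ∷ All.map (λ ⊆ys i i∈ → ∈-resp-↭ (↭-sym s) (∈-++⁺ʳ abc (⊆ys i i∈))) within
  }
  where
  abc : List (Fin n)
  abc = a ∷ b ∷ c ∷ []

  -- The three components give the size of `T`, the hypothesis of the recursive call, and the
  -- disjointness of `T` from the later triangles.
  parts : Unique abc × Unique ys × All (λ i → All (i ≢_) ys) abc
  parts = AllPairs-++⁻ abc (Unique-resp-↭ (setoid (Fin n)) (↭⇒↭ₛ s) xs!)

  abc! : Unique abc
  abc! = proj₁ parts

  T : Triangle n
  T = triangle abc!

  open Family (toFamily χ (proj₁ (proj₂ parts)) p)

  apart : ∀ (S : Triangle n) → (∀ i → i ∈ vertices S → i ∈ˡ ys) → Disjoint T S
  apart S ⊆ys (i , i∈) with x∈p∩q⁻ (vertices T) (vertices S) i∈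
  ... | i∈T , i∈S = All.lookup (All.lookup (proj₂ (proj₂ parts)) (∈-fromList⁻ abc i∈T)) (⊆ys i i∈S) refl

-- The upper bound

∣q∣<∣p∣⇒p⊈q : ∀ (p q : Subset n) → ∣ q ∣ < ∣ p ∣ → ∃[ i ] i ∈ p × i ∉ q
∣q∣<∣p∣⇒p⊈q p q q<p with any? (λ i → i ∈? p ×-dec ¬? (i ∈? q))
... | yes i∈p∖q = i∈p∖q
... | no  p∖q≡∅ = contradiction
  (p⊆q⇒∣p∣≤∣q∣ λ i∈p → decidable-stable (_ ∈? q) λ i∉q → p∖q≡∅ (_ , i∈p , i∉q))
  (<⇒≱ q<p)

cutColour : Side → Side → Colour
cutColour inside  inside  = red
cutColour outside outside = red
cutColour inside  outside = blue
cutColour outside inside  = blue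

cutColour-comm : ∀ s t → cutColour s t ≡ cutColour t s
cutColour-comm inside  inside  = refl
cutColour-comm inside  outside = refl
cutColour-comm outside inside  = refl
cutColour-comm outside outside = refl

-- The crossing edge is blue, while `u` lies on the same side as one of its ends and is joined to
-- that end in red.
no-mono-across : ∀ {s t c} u → s ≡ inside → t ≡ outside →
                 cutColour s t ≡ c → cutColour s u ≡ c → cutColour t u ≢ c
no-mono-across inside  refl refl refl ()
no-mono-across outside refl refl refl _ ()

cut : Subset n → Colouring n
cut U = record
  { colour    = λ i j → cutColour (Vec.lookup U i) (Vec.lookup U j)
  ; symmetric = λ i j → cutColour-comm (Vec.lookup U i) (Vec.lookup U j)
  }

-- A triangle meeting `U` in `i` is too big to lie inside `U`, so it has a vertex `j` outside. Its
-- third vertex `k` then contradicts `no-mono-across`.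
mono-avoids-small-side : ∀ (U : Subset n) → ∣ U ∣ < 3 → ∀ T → Monochromatic (cut U) T →
                         DisjointSubsets U (vertices T)
mono-avoids-small-side U U<3 T (c , monochromatic) (i , i∈)
  with i∈U , i∈T ← x∈p∩q⁻ U (vertices T) i∈
  with j , j∈T , j∉U ← ∣q∣<∣p∣⇒p⊈q (vertices T) U (subst (∣ U ∣ <_) (sym (size T)) U<3)
  with i≢j ← (i ≢ j ∋ λ { refl → j∉U i∈U })
  with k , k∈T , k∉ij ← ∣q∣<∣p∣⇒p⊈q (vertices T) (fromList (i ∷ j ∷ []))
         (≤-reflexive (trans (cong suc (∣fromList∣ ((i≢j ∷ []) ∷ [] ∷ []))) (sym (size T))))
  = no-mono-across (Vec.lookup U k)
      ([]=⇒lookup i∈U) (¬-not (j∉U ∘ lookup⇒[]= j U))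
      (monochromatic i j i∈T j∈T i≢j)
      (monochromatic i k i∈T k∈T λ { refl → k∉ij (∈-fromList⁺ {xs = i ∷ j ∷ []} (here refl)) })
      (monochromatic j k j∈T k∈T λ { refl → k∉ij (∈-fromList⁺ {xs = i ∷ j ∷ []} (there (here refl))) })

firstTwo : ∀ m → List (Fin (2 + m))
firstTwo m = 0F ∷ 1F ∷ []

firstTwo! : ∀ m → Unique (firstTwo m)
firstTwo! m = ((λ ()) ∷ []) ∷ [] ∷ []

cut-upper-bound : ∀ m k → HasDisjointMonochromaticTriangles (cut (fromList (firstTwo m))) k → k ≤ m / 3
cut-upper-bound m k (Ts , (monos , disjoint) , refl) =
  -- Cancelling the two vertices of `U` leaves `length Ts * 3 ≤ m`, which is then divided by 3.
  subst (_≤ m / 3) (m*n/n≡m (length Ts) 3) (/-monoˡ-≤ 3 (s≤s⁻¹ (s≤s⁻¹ 2+3∣Ts∣≤2+m)))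
  where
  U : Subset (2 + m)
  U = fromList (firstTwo m)

  Vs : List (Subset (2 + m))
  Vs = map vertices Ts

  ∣U∣≡2 : ∣ U ∣ ≡ 2
  ∣U∣≡2 = ∣fromList∣ (firstTwo! m)

  ∣⋃Vs∣ : ∣ ⋃ Vs ∣ ≡ length Ts * 3
  ∣⋃Vs∣ = trans (∣⋃∣≡length*size (AllPairs.map⁺ disjoint) (All.map⁺ (All.universal Triangle.size Ts)))
               (cong (_* 3) (length-map vertices Ts))

  U∩⋃Vs≡∅ : DisjointSubsets U (⋃ Vs)
  U∩⋃Vs≡∅ = disjoint-⋃ (All.map⁺
    (All.map (λ {T} → mono-avoids-small-side U (≤-reflexive (cong suc ∣U∣≡2)) T) monos))

  2+3∣Ts∣≤2+m : 2 + length Ts * 3 ≤ 2 + m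
  2+3∣Ts∣≤2+m = subst (_≤ 2 + m)
    (trans (∣p∪q∣≡∣p∣+∣q∣ U (⋃ Vs) U∩⋃Vs≡∅) (cong₂ _+_ ∣U∣≡2 ∣⋃Vs∣)) (∣p∣≤n (U ∪ ⋃ Vs))

-- The lower bound for colourings of the complete graph, and the minimum

lower-bound : ∀ m → 2 + m ≢ 5 → (χ : Colouring (2 + m)) → HasDisjointMonochromaticTriangles χ (m / 3)
lower-bound m n≢5 χ = triangles , mono-disj , count
  where
  length-allFin : length (allFin (2 + m)) ≡ 2 + m
  length-allFin = length-tabulate {n = 2 + m} id

  open Family (toFamily χ (allFin⁺ (2 + m))
    (packing (colour χ) (symmetric χ) (m / 3) (allFin (2 + m))
      -- Rounding down in `m / 3` gives `m / 3 * 3 ≤ m`, so there are enough vertices for `m / 3`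
      -- triangles.
      (subst (2 + m / 3 * 3 ≤_) (sym length-allFin) (s≤s (s≤s (m/n*n≤m m 3))))
      (n≢5 ∘ trans (sym length-allFin))))

corollary3p8 : (n : ℕ) → 2 ≤ n → n ≢ 5 →
    IsMinDisjointMonochromaticTriangles n ((n ∸ 2) / 3)
corollary3p8 (suc (suc m)) (s≤s (s≤s _)) n≢5 =
  (χ₀ , lower-bound m n≢5 χ₀ , cut-upper-bound m) ,
  -- The maximum for `χ` is at least every number of triangles attained in `χ`, in particular
  -- `m / 3`.
  λ k (χ , _ , maximal) → maximal (m / 3) (lower-bound m n≢5 χ)
  where
  χ₀ : Colouring (2 + m)
  χ₀ = cut (fromList (firstTwo m))
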